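{- Let $\alpha$ be any nonzero real number and let $n$ be any positive integer. Then $$\sum_{k=1}^{n}\Big(1-\frac{1}{\alpha}\Big)_k B_{n,k}\big((\alpha)_1,(\alpha)_2,\ldots,(\alpha)_{n-k+1}\big)=(\alpha-1)_n.$$
   Context: $(x)_k=x(x-1)(x-2)\cdots(x-k+1)$ denotes the falling factorial. For integers $1\le k\le n$, the partial exponential Bell polynomial is $$B_{n,k}(x_1,\ldots,x_{n-k+1})=n!\sum_{\Lambda^k_n}\prod_{j=1}^{n-k+1}\frac{1}{k_j!}\Big(\frac{x_j}{j!}\Big)^{k_j},$$ where the sum is over $\Lambda^k_n=\{(k_1,\ldots,k_{n-k+1}): \sum_j k_j=k,\ \sum_j jk_j=n,\ k_j\in\mathbb{Z}_{\ge 0}\}$. -}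

module Defs where

open import Algebra.Bundles using (CommutativeRing; Semiring)
import Algebra.Definitions.RawSemiring as RawSemiringDefs
open import Data.Fin.Base using (Fin; toℕ)
open import Data.Integer.Base using (+_)
open import Data.List.Base as List using (List; []; _∷_)
import Data.List.Properties as List
open import Data.List.Membership.Propositional using (_∈_)
open import Data.List.Membership.Propositional.Properties
  using (∈-filter⁺; ∈-filter⁻; ∈-cartesianProductWith⁺; ∈-upTo⁺)
open import Data.List.Relation.Unary.Any using (here)
import Data.List.Relation.Unary.All as All
import Data.List.Relation.Unary.AllPairs as AllPairs
open import Data.List.Relation.Unary.Unique.Propositional using (Unique)
import Data.List.Relation.Unary.Unique.Propositional.Properties as Unique
open import Data.Nat.Base as ℕ using (ℕ; zero; suc; _∸_; _!; _⊔_)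
import Data.Nat.Properties as ℕ
open import Data.Product.Base using (∃; _×_; _,_; proj₁; proj₂)
open import Data.Rational.Base as ℚ using (ℚ; 0ℚ; 1ℚ; ½)
import Data.Rational.Properties as ℚ
import Data.Rational.Solver as ℚ
open import Data.Vec.Base as Vec using (Vec; []; _∷_; lookup; tabulate)
import Data.Vec.Properties as Vec
open import Function.Bundles using (_⇔_; mk⇔)
open import Relation.Binary.PropositionalEquality
  using (_≡_; refl; sym; trans; cong; cong₂; subst)
open import Relation.Binary.Structures using (IsEquivalence)
open import Relation.Nullary.Decidable.Core using (Dec; yes; no; _×-dec_)
open import Relation.Nullary.Negation.Core using (contradiction)

private
  module S = ℚ.+-*-Solver

  ∣_-_∣ : ℚ → ℚ → ℚ
  ∣ p - q ∣ = ℚ.∣ p ℚ.- q ∣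

private
  ½+½ : ∀ ε → ½ ℚ.* ε ℚ.+ ½ ℚ.* ε ≡ ε
  ½+½ = S.solve 1 (λ e → S.con ½ S.:* e S.:+ S.con ½ S.:* e S.:= e) refl

  ½-pos : ∀ {ε} → 0ℚ ℚ.< ε → 0ℚ ℚ.< ½ ℚ.* ε
  ½-pos {ε} 0<ε = ℚ.positive⁻¹ (½ ℚ.* ε) {{ℚ.pos*pos⇒pos ½ ε {{ℚ.positive 0<ε}}}}

  0<p⇒∣p-p∣ : ∀ p {ε} → 0ℚ ℚ.< ε → ∣ p - p ∣ ℚ.< ε
  0<p⇒∣p-p∣ p 0<ε = subst (ℚ._< _) (sym (cong ℚ.∣_∣ (ℚ.+-inverseʳ p))) 0<ε

  close-sym : ∀ p q → ∣ p - q ∣ ≡ ∣ q - p ∣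
  close-sym p q = trans (sym (ℚ.∣-p∣≡∣p∣ (p ℚ.- q)))
    (cong ℚ.∣_∣ (S.solve 2 (λ a b → S.:- (a S.:- b) S.:= b S.:- a) refl p q))

  close-neg : ∀ p q → ∣ ℚ.- p - ℚ.- q ∣ ≡ ∣ p - q ∣
  close-neg p q = trans
    (cong ℚ.∣_∣ (S.solve 2 (λ a b → (S.:- a) S.:- (S.:- b) S.:= S.:- (a S.:- b)) refl p q))
    (ℚ.∣-p∣≡∣p∣ (p ℚ.- q))

  halves : ∀ {ε} p q → ℚ.∣ p ∣ ℚ.< ½ ℚ.* ε → ℚ.∣ q ∣ ℚ.< ½ ℚ.* ε → ℚ.∣ p ℚ.+ q ∣ ℚ.< ε
  halves {ε} p q p< q< = begin-strict
    ℚ.∣ p ℚ.+ q ∣            ≤⟨ ℚ.∣p+q∣≤∣p∣+∣q∣ p q ⟩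
    ℚ.∣ p ∣ ℚ.+ ℚ.∣ q ∣      <⟨ ℚ.+-mono-< p< q< ⟩
    ½ ℚ.* ε ℚ.+ ½ ℚ.* ε      ≡⟨ ½+½ ε ⟩
    ε                        ∎
    where open ℚ.≤-Reasoning

  close-trans : ∀ {ε} p q r →
    ∣ p - q ∣ ℚ.< ½ ℚ.* ε → ∣ q - r ∣ ℚ.< ½ ℚ.* ε → ∣ p - r ∣ ℚ.< ε
  close-trans {ε} p q r pq qr = subst (λ z → ℚ.∣ z ∣ ℚ.< ε)
    (S.solve 3 (λ a b c → (a S.:- b) S.:+ (b S.:- c) S.:= a S.:- c) refl p q r)
    (halves (p ℚ.- q) (q ℚ.- r) pq qr)

  close-+ : ∀ {ε} p q p′ q′ →
    ∣ p - p′ ∣ ℚ.< ½ ℚ.* ε → ∣ q - q′ ∣ ℚ.< ½ ℚ.* ε → ∣ p ℚ.+ q - p′ ℚ.+ q′ ∣ ℚ.< ε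
  close-+ {ε} p q p′ q′ pp qq = subst (λ z → ℚ.∣ z ∣ ℚ.< ε)
    (S.solve 4 (λ a b c d → (a S.:- c) S.:+ (b S.:- d) S.:= (a S.:+ b) S.:- (c S.:+ d))
      refl p q p′ q′)
    (halves (p ℚ.- p′) (q ℚ.- q′) pp qq)

  quotient : ∀ K ε → 0ℚ ℚ.< K → 0ℚ ℚ.< ε → ∃ λ δ → 0ℚ ℚ.< δ × K ℚ.* δ ≡ ε
  quotient K ε 0<K 0<ε = δ , 0<δ , Kδ≡ε
    where
    instance
      K-pos : ℚ.Positive K
      K-pos = ℚ.positive 0<K
      K≢0 : ℚ.NonZero K
      K≢0 = ℚ.pos⇒nonZero K
      ε-pos : ℚ.Positive ε
      ε-pos = ℚ.positive 0<ε
    δ : ℚ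
    δ = (ℚ.1/ K) ℚ.* ε
    0<δ : 0ℚ ℚ.< δ
    0<δ = ℚ.positive⁻¹ δ {{ℚ.pos*pos⇒pos (ℚ.1/ K) {{ℚ.1/pos⇒pos K}} ε}}
    Kδ≡ε : K ℚ.* δ ≡ ε
    Kδ≡ε = trans (sym (ℚ.*-assoc K (ℚ.1/ K) ε))
      (trans (cong (ℚ._* ε) (ℚ.*-inverseʳ K)) (ℚ.*-identityˡ ε))

  scale : ∀ {K η} p q → 0ℚ ℚ.< K → ℚ.∣ p ∣ ℚ.≤ K → K ℚ.* ℚ.∣ q ∣ ℚ.< η → ℚ.∣ p ℚ.* q ∣ ℚ.< η
  scale {K} {η} p q 0<K p≤K Kq<η = begin-strict
    ℚ.∣ p ℚ.* q ∣        ≡⟨ ℚ.∣p*q∣≡∣p∣*∣q∣ p q ⟩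
    ℚ.∣ p ∣ ℚ.* ℚ.∣ q ∣  ≤⟨ ℚ.*-monoʳ-≤-nonNeg ℚ.∣ q ∣ {{ℚ.∣-∣-nonNeg q}} p≤K ⟩
    K ℚ.* ℚ.∣ q ∣        <⟨ Kq<η ⟩
    η                    ∎
    where open ℚ.≤-Reasoning

  close-* : ∀ {K δ ε} p q p′ q′ → 0ℚ ℚ.< K → K ℚ.* δ ≡ ½ ℚ.* ε →
    ℚ.∣ p ∣ ℚ.≤ K → ℚ.∣ q′ ∣ ℚ.≤ K →
    ∣ p - p′ ∣ ℚ.< δ → ∣ q - q′ ∣ ℚ.< δ → ∣ p ℚ.* q - p′ ℚ.* q′ ∣ ℚ.< ε
  close-* {K} {δ} {ε} p q p′ q′ 0<K Kδ p≤K q′≤K pp qq = subst (λ z → ℚ.∣ z ∣ ℚ.< ε)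
    (S.solve 4 (λ a b c d → a S.:* (b S.:- d) S.:+ d S.:* (a S.:- c)
                            S.:= (a S.:* b) S.:- (c S.:* d)) refl p q p′ q′)
    (halves (p ℚ.* (q ℚ.- q′)) (q′ ℚ.* (p ℚ.- p′))
      (scale p (q ℚ.- q′) 0<K p≤K (bound qq))
      (scale q′ (p ℚ.- p′) 0<K q′≤K (bound pp)))
    where
    bound : ∀ {d} → d ℚ.< δ → K ℚ.* d ℚ.< ½ ℚ.* ε
    bound {d} d<δ = subst (K ℚ.* d ℚ.<_) Kδ
      (ℚ.*-monoʳ-<-pos K {{ℚ.positive 0<K}} d<δ)

Eventually : (ℕ → Set) → Set
Eventually P = ∃ λ N → ∀ n → N ℕ.≤ n → P n

IsCauchy : (ℕ → ℚ) → Set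
IsCauchy s = ∀ ε → 0ℚ ℚ.< ε →
  ∃ λ N → ∀ m n → N ℕ.≤ m → N ℕ.≤ n → ℚ.∣ s m ℚ.- s n ∣ ℚ.< ε

-- The real numbers: Cauchy sequences of rationals, with the setoid
-- equality _≃_ identifying sequences whose difference tends to 0.
record ℝ : Set where
  constructor mkℝ
  field
    seq    : ℕ → ℚ
    cauchy : IsCauchy seq

open ℝ public

infix 4 _≃_ _#_

_≃_ : ℝ → ℝ → Set
x ≃ y = ∀ ε → 0ℚ ℚ.< ε → Eventually λ n → ℚ.∣ seq x n ℚ.- seq y n ∣ ℚ.< ε

-- Apartness, i.e. |x - y| > 0: the constructive form of x ≠ y, classically
-- equivalent to the negation of x ≃ y.
_#_ : ℝ → ℝ → Set
x # y = ∃ λ ε → 0ℚ ℚ.< ε × Eventually λ n → ε ℚ.≤ ℚ.∣ seq x n ℚ.- seq y n ∣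

private
  infixr 2 _and_
  _and_ : ∀ {P Q : ℕ → Set} → Eventually P → Eventually Q → Eventually λ n → P n × Q n
  (M , p) and (N , q) = M ⊔ N , λ n le →
    p n (ℕ.m⊔n≤o⇒m≤o M N le) , q n (ℕ.m⊔n≤o⇒n≤o M N le)

  weaken : ∀ {P Q : ℕ → Set} → (∀ n → P n → Q n) → Eventually P → Eventually Q
  weaken f (N , p) = N , λ n le → f n (p n le)

  bounded : ∀ x → ∃ λ K → 0ℚ ℚ.< K × Eventually λ n → ℚ.∣ seq x n ∣ ℚ.≤ K
  bounded x with cauchy x 1ℚ (ℚ.positive⁻¹ 1ℚ)
  ... | N , c = 1ℚ ℚ.+ ℚ.∣ a ∣ , ℚ.+-mono-<-≤ (ℚ.positive⁻¹ 1ℚ) (ℚ.0≤∣p∣ a) , N , bound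
    where
    open ℚ.≤-Reasoning
    a = seq x N
    bound : ∀ n → N ℕ.≤ n → ℚ.∣ seq x n ∣ ℚ.≤ 1ℚ ℚ.+ ℚ.∣ a ∣
    bound n le = begin
      ℚ.∣ seq x n ∣
        ≡⟨ cong ℚ.∣_∣ (S.solve 2 (λ p q → p S.:= (p S.:- q) S.:+ q) refl (seq x n) a) ⟩
      ℚ.∣ (seq x n ℚ.- a) ℚ.+ a ∣
        ≤⟨ ℚ.∣p+q∣≤∣p∣+∣q∣ (seq x n ℚ.- a) a ⟩
      ∣ seq x n - a ∣ ℚ.+ ℚ.∣ a ∣
        ≤⟨ ℚ.+-monoˡ-≤ ℚ.∣ a ∣ (ℚ.<⇒≤ (c n N le ℕ.≤-refl)) ⟩
      1ℚ ℚ.+ ℚ.∣ a ∣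
        ∎

  p≤p+q : ∀ p q → 0ℚ ℚ.< q → p ℚ.≤ p ℚ.+ q
  p≤p+q p q 0<q = subst (ℚ._≤ p ℚ.+ q) (ℚ.+-identityʳ p) (ℚ.+-monoʳ-≤ p (ℚ.<⇒≤ 0<q))

  p≤q+p : ∀ p q → 0ℚ ℚ.< q → p ℚ.≤ q ℚ.+ p
  p≤q+p p q 0<q = subst (p ℚ.≤_) (ℚ.+-comm p q) (p≤p+q p q 0<q)

  +-pos : ∀ p q → 0ℚ ℚ.< p → 0ℚ ℚ.< q → 0ℚ ℚ.< p ℚ.+ q
  +-pos p q 0<p 0<q = ℚ.<-≤-trans 0<p (p≤p+q p q 0<q)

  bounded₂ : ∀ x y → ∃ λ K → 0ℚ ℚ.< K ×
    Eventually λ n → ℚ.∣ seq x n ∣ ℚ.≤ K × ℚ.∣ seq y n ∣ ℚ.≤ K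
  bounded₂ x y =
    let (K , 0<K , M , ex) = bounded x
        (L , 0<L , N , ey) = bounded y
    in K ℚ.+ L , +-pos K L 0<K 0<L , M ⊔ N , λ n le →
      ℚ.≤-trans (ex n (ℕ.m⊔n≤o⇒m≤o M N le)) (p≤p+q K L 0<L) ,
      ℚ.≤-trans (ey n (ℕ.m⊔n≤o⇒n≤o M N le)) (p≤q+p L K 0<K)

infix  8 -_
infixl 7 _*_
infixl 6 _+_

fromℚ : ℚ → ℝ
fromℚ q = mkℝ (λ _ → q) λ ε 0<ε → 0 , λ _ _ _ _ → 0<p⇒∣p-p∣ q 0<ε

fromℕ : ℕ → ℝ
fromℕ n = fromℚ (+ n ℚ./ 1)

0ℝ 1ℝ : ℝ
0ℝ = fromℚ 0ℚ
1ℝ = fromℚ 1ℚ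

_+_ : ℝ → ℝ → ℝ
x + y = mkℝ (λ n → seq x n ℚ.+ seq y n) isCauchy
  where
  abstract
    isCauchy : IsCauchy (λ n → seq x n ℚ.+ seq y n)
    isCauchy ε 0<ε with cauchy x (½ ℚ.* ε) (½-pos 0<ε) | cauchy y (½ ℚ.* ε) (½-pos 0<ε)
    ... | M , cx | N , cy = M ⊔ N , λ m n lm ln →
      close-+ (seq x m) (seq y m) (seq x n) (seq y n)
        (cx m n (ℕ.m⊔n≤o⇒m≤o M N lm) (ℕ.m⊔n≤o⇒m≤o M N ln))
        (cy m n (ℕ.m⊔n≤o⇒n≤o M N lm) (ℕ.m⊔n≤o⇒n≤o M N ln))

-_ : ℝ → ℝ
- x = mkℝ (λ n → ℚ.- seq x n) λ ε 0<ε →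
  let (N , c) = cauchy x ε 0<ε in
  N , λ m n lm ln → subst (ℚ._< ε) (sym (close-neg (seq x m) (seq x n))) (c m n lm ln)

_*_ : ℝ → ℝ → ℝ
x * y = mkℝ (λ n → seq x n ℚ.* seq y n) isCauchy
  where
  abstract
    isCauchy : IsCauchy (λ n → seq x n ℚ.* seq y n)
    isCauchy ε 0<ε =
      let (K , 0<K , B , b) = bounded₂ x y
          (δ , 0<δ , Kδ)    = quotient K (½ ℚ.* ε) 0<K (½-pos 0<ε)
          (M , cx)          = cauchy x δ 0<δ
          (N , cy)          = cauchy y δ 0<δ
          toB : ∀ {o} → B ⊔ (M ⊔ N) ℕ.≤ o → B ℕ.≤ o
          toB = ℕ.m⊔n≤o⇒m≤o B (M ⊔ N)
          toM : ∀ {o} → B ⊔ (M ⊔ N) ℕ.≤ o → M ℕ.≤ o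
          toM le = ℕ.m⊔n≤o⇒m≤o M N (ℕ.m⊔n≤o⇒n≤o B (M ⊔ N) le)
          toN : ∀ {o} → B ⊔ (M ⊔ N) ℕ.≤ o → N ℕ.≤ o
          toN le = ℕ.m⊔n≤o⇒n≤o M N (ℕ.m⊔n≤o⇒n≤o B (M ⊔ N) le)
      in B ⊔ (M ⊔ N) , λ m n lm ln →
        close-* (seq x m) (seq y m) (seq x n) (seq y n) 0<K Kδ
          (proj₁ (b m (toB lm))) (proj₂ (b n (toB ln)))
          (cx m n (toM lm) (toM ln)) (cy m n (toN lm) (toN ln))

pointwise⇒≃ : ∀ {x y} → (∀ n → seq x n ≡ seq y n) → x ≃ y
pointwise⇒≃ {x} {y} eq ε 0<ε = 0 , λ n _ →
  subst (λ q → ∣ q - seq y n ∣ ℚ.< ε) (sym (eq n)) (0<p⇒∣p-p∣ (seq y n) 0<ε)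

≃-isEquivalence : IsEquivalence _≃_
≃-isEquivalence = record
  { refl  = λ {x} → pointwise⇒≃ {x} {x} λ _ → refl
  ; sym   = λ {x} {y} x≃y ε 0<ε → weaken
      (λ n → subst (ℚ._< ε) (close-sym (seq x n) (seq y n))) (x≃y ε 0<ε)
  ; trans = λ {x} {y} {z} x≃y y≃z ε 0<ε → weaken
      (λ n (p , q) → close-trans (seq x n) (seq y n) (seq z n) p q)
      (x≃y _ (½-pos 0<ε) and y≃z _ (½-pos 0<ε))
  }

+-cong : ∀ {x x′ y y′} → x ≃ x′ → y ≃ y′ → x + y ≃ x′ + y′
+-cong {x} {x′} {y} {y′} xx yy ε 0<ε = weaken
  (λ n (p , q) → close-+ (seq x n) (seq y n) (seq x′ n) (seq y′ n) p q)
  (xx _ (½-pos 0<ε) and yy _ (½-pos 0<ε))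

-‿cong : ∀ {x x′} → x ≃ x′ → - x ≃ - x′
-‿cong {x} {x′} xx ε 0<ε = weaken
  (λ n → subst (ℚ._< ε) (sym (close-neg (seq x n) (seq x′ n)))) (xx ε 0<ε)

*-cong : ∀ {x x′ y y′} → x ≃ x′ → y ≃ y′ → x * y ≃ x′ * y′
*-cong {x} {x′} {y} {y′} xx yy ε 0<ε =
  let (K , 0<K , b)  = bounded₂ x y′
      (δ , 0<δ , Kδ) = quotient K (½ ℚ.* ε) 0<K (½-pos 0<ε)
  in weaken
    (λ n ((p , q) , r , s) → close-* (seq x n) (seq y n) (seq x′ n) (seq y′ n) 0<K Kδ p q r s)
    (b and xx δ 0<δ and yy δ 0<δ)

ℝ-commutativeRing : CommutativeRing _ _
ℝ-commutativeRing = record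
  { Carrier = ℝ ; _≈_ = _≃_ ; _+_ = _+_ ; _*_ = _*_ ; -_ = -_ ; 0# = 0ℝ ; 1# = 1ℝ
  ; isCommutativeRing = record
    { isRing = record
      { +-isAbelianGroup = record
        { isGroup = record
          { isMonoid = record
            { isSemigroup = record
              { isMagma = record
                { isEquivalence = ≃-isEquivalence
                ; ∙-cong = λ {x} {x′} {y} {y′} → +-cong {x} {x′} {y} {y′}
                }
              ; assoc = λ x y z → pointwise⇒≃ {(x + y) + z} {x + (y + z)}
                  λ n → ℚ.+-assoc (seq x n) (seq y n) (seq z n)
              }
            ; identity = (λ x → pointwise⇒≃ {0ℝ + x} {x} λ n → ℚ.+-identityˡ (seq x n))
                       , (λ x → pointwise⇒≃ {x + 0ℝ} {x} λ n → ℚ.+-identityʳ (seq x n))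
            }
          ; inverse = (λ x → pointwise⇒≃ { - x + x} {0ℝ} λ n → ℚ.+-inverseˡ (seq x n))
                    , (λ x → pointwise⇒≃ {x + - x} {0ℝ} λ n → ℚ.+-inverseʳ (seq x n))
          ; ⁻¹-cong = λ {x} {x′} → -‿cong {x} {x′}
          }
        ; comm = λ x y → pointwise⇒≃ {x + y} {y + x} λ n → ℚ.+-comm (seq x n) (seq y n)
        }
      ; *-cong = λ {x} {x′} {y} {y′} → *-cong {x} {x′} {y} {y′}
      ; *-assoc = λ x y z → pointwise⇒≃ {(x * y) * z} {x * (y * z)}
          λ n → ℚ.*-assoc (seq x n) (seq y n) (seq z n)
      ; *-identity = (λ x → pointwise⇒≃ {1ℝ * x} {x} λ n → ℚ.*-identityˡ (seq x n))
                   , (λ x → pointwise⇒≃ {x * 1ℝ} {x} λ n → ℚ.*-identityʳ (seq x n))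
      ; distrib = (λ x y z → pointwise⇒≃ {x * (y + z)} {x * y + x * z}
                    λ n → ℚ.*-distribˡ-+ (seq x n) (seq y n) (seq z n))
                , (λ x y z → pointwise⇒≃ {(y + z) * x} {y * x + z * x}
                    λ n → ℚ.*-distribʳ-+ (seq x n) (seq y n) (seq z n))
      }
    ; *-comm = λ x y → pointwise⇒≃ {x * y} {y * x} λ n → ℚ.*-comm (seq x n) (seq y n)
    }
  }

open CommutativeRing ℝ-commutativeRing public using (_-_)
open RawSemiringDefs (Semiring.rawSemiring (CommutativeRing.semiring ℝ-commutativeRing)) public
  using (sum; product; _^_)

recipℚ : ℚ → ℚ
recipℚ p with p ℚ.≟ 0ℚ
... | yes _   = 0ℚ
... | no p≢0 = ℚ.1/_ p {{ℚ.≢-nonZero p≢0}}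

private
  recipℚ-inverseʳ : ∀ {η} p → 0ℚ ℚ.< η → η ℚ.≤ ∣ p - 0ℚ ∣ → p ℚ.* recipℚ p ≡ 1ℚ
  recipℚ-inverseʳ p 0<η η≤ with p ℚ.≟ 0ℚ
  ... | yes refl = contradiction (ℚ.<-≤-trans 0<η η≤) (ℚ.<-irrefl refl)
  ... | no p≢0  = ℚ.*-inverseʳ p {{ℚ.≢-nonZero p≢0}}

  close-recip : ∀ {η ε} p q → 0ℚ ℚ.< η → η ℚ.≤ ∣ p - 0ℚ ∣ → η ℚ.≤ ∣ q - 0ℚ ∣ →
    ∣ p - q ∣ ℚ.< η ℚ.* η ℚ.* ε → ∣ recipℚ p - recipℚ q ∣ ℚ.< ε
  close-recip {η} {ε} p q 0<η η≤p η≤q pq =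
    ℚ.*-cancelˡ-<-nonNeg (η ℚ.* η) (begin-strict
      η ℚ.* η ℚ.* ∣ p′ - q′ ∣
        ≤⟨ ℚ.*-monoʳ-≤-nonNeg ∣ p′ - q′ ∣ {{ℚ.∣-∣-nonNeg (p′ ℚ.- q′)}} ηη≤ ⟩
      ℚ.∣ p ℚ.* q ∣ ℚ.* ∣ p′ - q′ ∣
        ≡⟨ ℚ.∣p*q∣≡∣p∣*∣q∣ (p ℚ.* q) (p′ ℚ.- q′) ⟨
      ℚ.∣ p ℚ.* q ℚ.* (p′ ℚ.- q′) ∣
        ≡⟨ cong ℚ.∣_∣ eq ⟩
      ∣ q - p ∣
        ≡⟨ close-sym q p ⟩
      ∣ p - q ∣
        <⟨ pq ⟩
      η ℚ.* η ℚ.* ε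
        ∎)
    where
    open ℚ.≤-Reasoning
    p′ = recipℚ p
    q′ = recipℚ q
    instance
      η-pos : ℚ.Positive η
      η-pos = ℚ.positive 0<η
      η-nonNeg : ℚ.NonNegative η
      η-nonNeg = ℚ.pos⇒nonNeg η
      ηη-nonNeg : ℚ.NonNegative (η ℚ.* η)
      ηη-nonNeg = ℚ.pos⇒nonNeg (η ℚ.* η) {{ℚ.pos*pos⇒pos η η}}
    η≤∣_∣ : ∀ r → η ℚ.≤ ∣ r - 0ℚ ∣ → η ℚ.≤ ℚ.∣ r ∣
    η≤∣ r ∣ = subst (η ℚ.≤_) (cong ℚ.∣_∣ (ℚ.+-identityʳ r))
    ηη≤ : η ℚ.* η ℚ.≤ ℚ.∣ p ℚ.* q ∣
    ηη≤ = begin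
      η ℚ.* η              ≤⟨ ℚ.*-monoˡ-≤-nonNeg η (η≤∣ q ∣ η≤q) ⟩
      η ℚ.* ℚ.∣ q ∣        ≤⟨ ℚ.*-monoʳ-≤-nonNeg ℚ.∣ q ∣ {{ℚ.∣-∣-nonNeg q}} (η≤∣ p ∣ η≤p) ⟩
      ℚ.∣ p ∣ ℚ.* ℚ.∣ q ∣  ≡⟨ ℚ.∣p*q∣≡∣p∣*∣q∣ p q ⟨
      ℚ.∣ p ℚ.* q ∣        ∎
    eq : p ℚ.* q ℚ.* (p′ ℚ.- q′) ≡ q ℚ.- p
    eq = trans
      (S.solve 4 (λ a b c d → a S.:* b S.:* (c S.:- d)
                   S.:= (a S.:* c) S.:* b S.:- (b S.:* d) S.:* a) refl p q p′ q′)
      (cong₂ ℚ._-_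
        (trans (cong (ℚ._* q) (recipℚ-inverseʳ p 0<η η≤p)) (ℚ.*-identityˡ q))
        (trans (cong (ℚ._* p) (recipℚ-inverseʳ q 0<η η≤q)) (ℚ.*-identityˡ p)))

1/_[_] : (x : ℝ) → x # 0ℝ → ℝ
1/ x [ η , 0<η , E , e ] = mkℝ (λ n → recipℚ (seq x n)) isCauchy
  where
  abstract
    isCauchy : IsCauchy (λ n → recipℚ (seq x n))
    isCauchy ε 0<ε with cauchy x (η ℚ.* η ℚ.* ε) 0<ηηε
      where
      0<ηη : ℚ.Positive (η ℚ.* η)
      0<ηη = ℚ.pos*pos⇒pos η {{ℚ.positive 0<η}} η {{ℚ.positive 0<η}}
      0<ηηε : 0ℚ ℚ.< η ℚ.* η ℚ.* ε
      0<ηηε = ℚ.positive⁻¹ _ {{ℚ.pos*pos⇒pos (η ℚ.* η) {{0<ηη}} ε {{ℚ.positive 0<ε}}}}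
    ... | N , c = E ⊔ N , λ m n lm ln → close-recip (seq x m) (seq x n) 0<η
      (e m (ℕ.m⊔n≤o⇒m≤o E N lm)) (e n (ℕ.m⊔n≤o⇒m≤o E N ln))
      (c m n (ℕ.m⊔n≤o⇒n≤o E N lm) (ℕ.m⊔n≤o⇒n≤o E N ln))

*-inverseʳ : ∀ x (x#0 : x # 0ℝ) → x * 1/ x [ x#0 ] ≃ 1ℝ
*-inverseʳ x (η , 0<η , E , e) ε 0<ε = E , λ n le →
  subst (λ q → ∣ q - 1ℚ ∣ ℚ.< ε) (sym (recipℚ-inverseʳ (seq x n) 0<η (e n le)))
    (0<p⇒∣p-p∣ 1ℚ 0<ε)

infixl 7 _/ℕ_
_/ℕ_ : ℝ → (d : ℕ) → .{{ℕ.NonZero d}} → ℝ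
x /ℕ d = x * fromℚ (+ 1 ℚ./ d)

infixl 7 _/_!
_/_! : ℝ → ℕ → ℝ
x / k ! = _/ℕ_ x (k !) {{k ℕ.!≢0}}

falling : ℝ → ℕ → ℝ
falling x zero    = 1ℝ
falling x (suc k) = falling x k * (x - fromℕ k)

-- A vector v of length m stands for (k₁, …, kₘ), so entry i is k_{i+1}.
weight : ∀ {m} → Vec ℕ m → ℕ
weight v = Vec.sum (tabulate λ i → suc (toℕ i) ℕ.* lookup v i)

InΛ : (n k : ℕ) → Vec ℕ (suc (n ∸ k)) → Set
InΛ n k v = Vec.sum v ≡ k × weight v ≡ n

InΛ? : ∀ n k v → Dec (InΛ n k v)
InΛ? n k v = (Vec.sum v ℕ.≟ k) ×-dec (weight v ℕ.≟ n)

box : ℕ → (m : ℕ) → List (Vec ℕ m)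
box b zero    = [] ∷ []
box b (suc m) = List.cartesianProductWith _∷_ (List.upTo (suc b)) (box b m)

-- Searching the box of vectors with entries at most k loses nothing, since
-- the entries sum to k; ∈Λ⇔InΛ and Λ-unique say that Λ n k lists exactly the
-- vectors satisfying InΛ, each once.
Λ : (n k : ℕ) → List (Vec ℕ (suc (n ∸ k)))
Λ n k = List.filter (InΛ? n k) (box k (suc (n ∸ k)))

∈-box : ∀ {b m} (v : Vec ℕ m) → Vec.sum v ℕ.≤ b → v ∈ box b m
∈-box []      _  = here refl
∈-box (a ∷ v) le = ∈-cartesianProductWith⁺ _∷_
  (∈-upTo⁺ (ℕ.s≤s (ℕ.m+n≤o⇒m≤o a le))) (∈-box v (ℕ.m+n≤o⇒n≤o a le))

∈Λ⇔InΛ : ∀ n k v → v ∈ Λ n k ⇔ InΛ n k v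
∈Λ⇔InΛ n k v = mk⇔
  (λ v∈ → proj₂ (∈-filter⁻ (InΛ? n k) {xs = box k (suc (n ∸ k))} v∈))
  (λ p → ∈-filter⁺ (InΛ? n k) (∈-box v (ℕ.≤-reflexive (proj₁ p))) p)

box-unique : ∀ b m → Unique (box b m)
box-unique b zero    = All.[] AllPairs.∷ AllPairs.[]
box-unique b (suc m) = Unique.cartesianProductWith⁺ _∷_ Vec.∷-injective
  (Unique.upTo⁺ (suc b)) (box-unique b m)

Λ-unique : ∀ n k → Unique (Λ n k)
Λ-unique n k = Unique.filter⁺ (InΛ? n k) (box-unique k (suc (n ∸ k)))

∑ₗ : ∀ {A : Set} → List A → (A → ℝ) → ℝ
∑ₗ xs f = List.foldr _+_ 0ℝ (List.map f xs)

-- Meant for 1 ≤ k ≤ n; the argument x i is x_{i+1}, for 0 ≤ i ≤ n - k.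
Bell : (n k : ℕ) → (Fin (suc (n ∸ k)) → ℝ) → ℝ
Bell n k x = fromℕ (n !) * ∑ₗ (Λ n k) λ v → product λ i →
  1ℝ / lookup v i ! * (x i / suc (toℕ i) !) ^ lookup v i

{-# OPTIONS --safe #-}

-- With f = (1 + t)^α - 1, the sum of (β)_k B_{n,k} over k is n! times the
-- coefficient T_n of t^n in (1 + f)^β = (1 + t)^{αβ}; the theorem is the case
-- β = 1 - 1/α. Power series are avoided: T_n is a sum over exponent vectors v
-- of ∏ y_i^{v_i} / v_i! · φ(∑ v_i, ∑ i v_i), where y_i = (α)_i / i! and φ is a
-- test function. Removing one unit from coordinate i trades a factor v_i for a
-- factor y_i and a shift of φ, so that
--   (i + 1) y_{i+1} + i y_i = α y_i   and   (β)_{k+1} + k (β)_k = β (β)_k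
-- yield (n + 1) T_{n+1} + n T_n = αβ T_n, the recurrence of (αβ)_n / n!.
module Submission where

open import Algebra.Bundles using (CommutativeRing; Semiring)
import Algebra.Definitions.RawSemiring as RawSemiringDefs
import Algebra.Properties.CommutativeSemigroup as CommutativeSemigroupProperties
import Algebra.Properties.Group as GroupProperties
import Algebra.Properties.Ring as RingProperties
import Algebra.Properties.Semiring.Sum as Sum
import Algebra.Solver.Ring.NaturalCoefficients.Default as SemiringSolver
open import Data.Fin.Base using (toℕ)
open import Data.Fin.Properties using (toℕ<n)
open import Data.Integer.Base using (+_)
import Data.Integer.Solver as ℤ
open import Data.List.Base as List
  using (List; []; _∷_; _++_; applyUpTo; upTo; cartesianProductWith; filter)
open import Data.Nat.Base as ℕ using (ℕ; zero; suc; z≤n; s≤s; NonZero; _!; _∸_)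
import Data.Nat.Properties as ℕ
import Data.Nat.Solver as ℕ
open import Data.Product.Base using (_×_; _,_)
open import Data.Rational.Base as ℚ using (1ℚ)
import Data.Rational.Properties as ℚ
open import Data.Rational.Unnormalised.Base as ℚᵘ using (mkℚᵘ; *≡*)
import Data.Rational.Unnormalised.Properties as ℚᵘ
open import Data.Vec.Base as Vec using (Vec; []; _∷_; lookup; tabulate)
open import Defs using (box; Λ; InΛ?)
open import Function.Base using (_∘_; id)
open import Level using (_⊔_) renaming (suc to lsuc)
open import Relation.Binary.PropositionalEquality as ≡ using (_≡_; _≢_)
import Relation.Binary.Reasoning.Setoid as SetoidReasoning
open import Relation.Binary.Structures using (IsEquivalence)
open import Relation.Nullary using (yes; no; ¬_; contradiction)
open import Relation.Unary using (Decidable)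

-- Commutative rings with inverse factorials and falling factorials.

-- falling is a field because recursive functions with different names are never
-- definitionally equal: a local copy could not match the one at ℝ.
record FactorialRing c ℓ : Set (lsuc (c ⊔ ℓ)) where
  field
    commutativeRing : CommutativeRing c ℓ
  open CommutativeRing commutativeRing public
  field
    nat          : ℕ → Carrier
    nat-zero     : nat 0 ≈ 0#
    nat-suc      : ∀ n → nat (suc n) ≈ 1# + nat n
    inv!         : ℕ → Carrier
    inv!-zero    : inv! 0 ≈ 1#
    inv!-suc     : ∀ n → nat (suc n) * inv! (suc n) ≈ inv! n
    falling      : Carrier → ℕ → Carrier
    falling-zero : ∀ x → falling x 0 ≈ 1#
    falling-suc  : ∀ x k → falling x (suc k) ≈ falling x k * (x - nat k)

module BellSums {c ℓ} (R : FactorialRing c ℓ) where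

  open FactorialRing R
  open RawSemiringDefs (Semiring.rawSemiring semiring) using (sum; product; _^_)
  open Sum semiring using (sum-cong-≋; ∑-distrib-+; ∑-comm; *-distribˡ-sum; sum-replicate-zero)
  open SetoidReasoning setoid
  open CommutativeSemigroupProperties ℕ.+-commutativeSemigroup
    using () renaming (x∙yz≈y∙xz to ℕ-swap)
  open CommutativeSemigroupProperties *-commutativeSemigroup
    using () renaming (x∙yz≈y∙xz to *-swap)
  open SemiringSolver commutativeSemiring using (solve; con; _:*_; _:+_; _:=_)

  -- Natural numbers in the ring and finite sums.

  nat-+ : ∀ m n → nat (m ℕ.+ n) ≈ nat m + nat n
  nat-+ zero    n = sym (trans (+-congʳ nat-zero) (+-identityˡ _))
  nat-+ (suc m) n = begin
    nat (suc (m ℕ.+ n))    ≈⟨ nat-suc _ ⟩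
    1# + nat (m ℕ.+ n)     ≈⟨ +-congˡ (nat-+ m n) ⟩
    1# + (nat m + nat n)   ≈⟨ +-assoc _ _ _ ⟨
    1# + nat m + nat n     ≈⟨ +-congʳ (nat-suc m) ⟨
    nat (suc m) + nat n    ∎

  nat-* : ∀ m n → nat (m ℕ.* n) ≈ nat m * nat n
  nat-* zero    n = trans nat-zero (sym (trans (*-congʳ nat-zero) (zeroˡ _)))
  nat-* (suc m) n = begin
    nat (n ℕ.+ m ℕ.* n)       ≈⟨ nat-+ n (m ℕ.* n) ⟩
    nat n + nat (m ℕ.* n)     ≈⟨ +-cong (sym (*-identityˡ _)) (nat-* m n) ⟩
    1# * nat n + nat m * nat n ≈⟨ distribʳ _ _ _ ⟨
    (1# + nat m) * nat n      ≈⟨ *-congʳ (nat-suc m) ⟨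
    nat (suc m) * nat n       ∎

  nat-one : nat 1 ≈ 1#
  nat-one = trans (nat-suc 0) (trans (+-congˡ nat-zero) (+-identityʳ 1#))

  -- Opaque because the unfolded sum hides its summand from unification.
  opaque
    ∑< : ℕ → (ℕ → Carrier) → Carrier
    ∑< n f = sum {n} λ i → f (toℕ i)

    ∑<-sum : ∀ n f → ∑< n f ≈ sum {n} λ i → f (toℕ i)
    ∑<-sum n f = refl

    ∑<-none : ∀ f → ∑< 0 f ≈ 0#
    ∑<-none f = refl

    ∑<-head : ∀ n f → ∑< (suc n) f ≈ f 0 + ∑< n (f ∘ suc)
    ∑<-head n f = refl

    ∑<-cong : ∀ n {f g} → (∀ i → f i ≈ g i) → ∑< n f ≈ ∑< n g
    ∑<-cong n f≈g = sum-cong-≋ {n} λ i → f≈g (toℕ i)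

    ∑<-+ : ∀ n f g → ∑< n (λ i → f i + g i) ≈ ∑< n f + ∑< n g
    ∑<-+ n f g = ∑-distrib-+ {n} (λ i → f (toℕ i)) (λ i → g (toℕ i))

    ∑<-*ˡ : ∀ n x f → ∑< n (λ i → x * f i) ≈ x * ∑< n f
    ∑<-*ˡ n x f = sym (*-distribˡ-sum {n} x λ i → f (toℕ i))

    ∑<-zero : ∀ n {f} → (∀ i → f i ≈ 0#) → ∑< n f ≈ 0#
    ∑<-zero n f≈0 = trans (∑<-cong n f≈0) (sum-replicate-zero n)

    ∑<-swap : ∀ m n (f : ℕ → ℕ → Carrier) →
      ∑< m (λ i → ∑< n (f i)) ≈ ∑< n (λ j → ∑< m (λ i → f i j))
    ∑<-swap m n f = ∑-comm {m} {n} λ i j → f (toℕ i) (toℕ j)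

    ∑<-last : ∀ n f → ∑< (suc n) f ≈ ∑< n f + f n
    ∑<-last zero    f = trans (+-identityʳ _) (sym (+-identityˡ _))
    ∑<-last (suc n) f = trans (+-congˡ (∑<-last n (f ∘ suc))) (sym (+-assoc _ _ _))

    -- Keeps the number of terms under the index shift, so that the result can be combined with
    -- other sums of length `n`.
    ∑<-shift : ∀ n f → f n ≈ 0# → ∑< n f ≈ f 0 + ∑< n (f ∘ suc)
    ∑<-shift n f fn≈0 = begin
      ∑< n f         ≈⟨ +-identityʳ _ ⟨
      ∑< n f + 0#    ≈⟨ +-congˡ fn≈0 ⟨
      ∑< n f + f n   ≈⟨ ∑<-last n f ⟨
      ∑< (suc n) f   ∎

  -- Sums over a box of exponent vectors.

  -- The sum over v in box b m of ∏ y_i^{v_i} / v_i! · φ(∑ v_i, ∑ (d_i + 1) v_i),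
  -- see ∑ₗ-box; writing weights as successors makes them positive.
  ∑Box : (d : ℕ → ℕ) (y : ℕ → Carrier) (b m : ℕ) (φ : ℕ → ℕ → Carrier) → Carrier
  ∑Box d y b zero    φ = φ 0 0
  ∑Box d y b (suc m) φ = ∑< (suc b) λ a → inv! a * y 0 ^ a *
    ∑Box (d ∘ suc) (y ∘ suc) b m (λ k w → φ (a ℕ.+ k) (suc (d 0) ℕ.* a ℕ.+ w))

  -- The weights `suc (d i)` are positive, so the total exponent `k` never exceeds the weight `w`;
  -- and `k = 0` only for the zero vector, whose weight is 0. Only such pairs reach the test
  -- function.
  ∑Box-cong-on : ∀ d y b m {φ ψ} →
    (∀ k w → k ℕ.≤ w → (k ≡ 0 → w ≡ 0) → φ k w ≈ ψ k w) →
    ∑Box d y b m φ ≈ ∑Box d y b m ψ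
  ∑Box-cong-on d y b zero    φ≈ψ = φ≈ψ 0 0 z≤n λ _ → ≡.refl
  ∑Box-cong-on d y b (suc m) φ≈ψ = ∑<-cong (suc b) λ a → *-congˡ
    (∑Box-cong-on (d ∘ suc) (y ∘ suc) b m λ k w k≤w k0 → φ≈ψ _ _
      (ℕ.+-mono-≤ (ℕ.m≤n*m a (suc (d 0))) k≤w) (pos a k w k0))
    where
    pos : ∀ a k w → (k ≡ 0 → w ≡ 0) → a ℕ.+ k ≡ 0 → suc (d 0) ℕ.* a ℕ.+ w ≡ 0
    pos zero k w k0 eq = ≡.cong₂ ℕ._+_ (ℕ.*-zeroʳ (d 0)) (k0 eq)

  ∑Box-cong : ∀ d y b m {φ ψ} → (∀ k w → φ k w ≈ ψ k w) → ∑Box d y b m φ ≈ ∑Box d y b m ψ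
  ∑Box-cong d y b m φ≈ψ = ∑Box-cong-on d y b m λ k w _ _ → φ≈ψ k w

  ∑Box-+ : ∀ d y b m φ ψ →
    ∑Box d y b m (λ k w → φ k w + ψ k w) ≈ ∑Box d y b m φ + ∑Box d y b m ψ
  ∑Box-+ d y b zero    φ ψ = refl
  ∑Box-+ d y b (suc m) φ ψ = trans
    (∑<-cong (suc b) λ a → trans (*-congˡ (∑Box-+ (d ∘ suc) (y ∘ suc) b m _ _)) (distribˡ _ _ _))
    (∑<-+ (suc b) _ _)

  ∑Box-*ˡ : ∀ d y b m x φ → ∑Box d y b m (λ k w → x * φ k w) ≈ x * ∑Box d y b m φ
  ∑Box-*ˡ d y b zero    x φ = refl
  ∑Box-*ˡ d y b (suc m) x φ = trans
    (∑<-cong (suc b) λ a → trans (*-congˡ (∑Box-*ˡ (d ∘ suc) (y ∘ suc) b m x _)) (*-swap _ _ _))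
    (∑<-*ˡ (suc b) x _)

  ∑Box-zero : ∀ d y b m {φ} → (∀ k w → φ k w ≈ 0#) → ∑Box d y b m φ ≈ 0#
  ∑Box-zero d y b zero    φ≈0 = φ≈0 0 0
  ∑Box-zero d y b (suc m) φ≈0 = ∑<-zero (suc b) λ a →
    trans (*-congˡ (∑Box-zero (d ∘ suc) (y ∘ suc) b m λ _ _ → φ≈0 _ _)) (zeroʳ _)

  ∑Box-∑ : ∀ d y b m n (x : ℕ → Carrier) (φ : ℕ → ℕ → ℕ → Carrier) →
    ∑Box d y b m (λ k w → ∑< n λ i → x i * φ i k w) ≈ ∑< n λ i → x i * ∑Box d y b m (φ i)
  ∑Box-∑ d y b m zero    x φ =
    trans (∑Box-zero d y b m λ _ _ → ∑<-none _) (sym (∑<-none _))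
  ∑Box-∑ d y b m (suc n) x φ = begin
    ∑Box d y b m (λ k w → ∑< (suc n) λ i → x i * φ i k w)
      ≈⟨ ∑Box-cong d y b m (λ k w → ∑<-head n _) ⟩
    ∑Box d y b m (λ k w → x 0 * φ 0 k w + ∑< n λ i → x (suc i) * φ (suc i) k w)
      ≈⟨ ∑Box-+ d y b m _ _ ⟩
    ∑Box d y b m (λ k w → x 0 * φ 0 k w) +
    ∑Box d y b m (λ k w → ∑< n λ i → x (suc i) * φ (suc i) k w)
      ≈⟨ +-cong (∑Box-*ˡ d y b m (x 0) (φ 0)) (∑Box-∑ d y b m n (x ∘ suc) (φ ∘ suc)) ⟩
    _
      ≈⟨ ∑<-head n _ ⟨
    (∑< (suc n) λ i → x i * ∑Box d y b m (φ i)) ∎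

  -- Removing one unit from a coordinate.

  -- Treats two Euler identities at once: `(0, 1)` weighs a vector by its degree, `(1, 0)` by its
  -- number of units.
  linear : (p q : Carrier) → ℕ → ℕ → Carrier
  linear p q k w = p * nat k + q * nat w

  -- v_i / v_i! = 1 / (v_i - 1)! lets each unit of v be peeled off; the support
  -- hypothesis kills the exponent b + 1 that leaves the box.
  euler : ∀ p q d y b m (φ : ℕ → ℕ → Carrier) → (∀ k w → b ℕ.< w → φ k w ≈ 0#) →
    ∑Box d y b m (λ k w → linear p q k w * φ k w) ≈
    ∑< m λ i → linear p q 1 (suc (d i)) * y i *
      ∑Box d y b m (λ k w → φ (suc k) (suc (d i) ℕ.+ w))
  euler p q d y b zero    φ supp = begin
    (p * nat 0 + q * nat 0) * φ 0 0
      ≈⟨ *-congʳ (+-cong (*-congˡ nat-zero) (*-congˡ nat-zero)) ⟩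
    (p * 0# + q * 0#) * φ 0 0
      ≈⟨ lem p q (φ 0 0) ⟩
    0#
      ≈⟨ ∑<-none _ ⟨
    _ ∎
    where
    lem : ∀ p q x → (p * 0# + q * 0#) * x ≈ 0#
    lem = solve 3 (λ p q x → (p :* con 0 :+ q :* con 0) :* x := con 0) refl
  euler p q d y b (suc m) φ supp = begin
    ∑< (suc b) (λ a → t a * S (λ k w → L (a ℕ.+ k) (c₀ ℕ.* a ℕ.+ w) * φ′ a k w))
      -- `L` is additive: coordinate 0 contributes `nat a * L 1 c₀`, and the induction hypothesis
      -- handles the other coordinates.
      ≈⟨ ∑<-cong (suc b) (λ a → *-congˡ (inner a)) ⟩
    ∑< (suc b) (λ a → t a * (nat a * L 1 c₀ * S (φ′ a) + ∑< m (λ i → g i * Ψ a i)))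
      ≈⟨ ∑<-cong (suc b) (λ a → split a) ⟩
    ∑< (suc b) (λ a → F a + ∑< m (λ i → g i * (t a * Ψ a i)))
      ≈⟨ ∑<-+ (suc b) _ _ ⟩
    ∑< (suc b) F + ∑< (suc b) (λ a → ∑< m (λ i → g i * (t a * Ψ a i)))
      ≈⟨ +-cong first second ⟩
    g₀ * ∑< (suc b) (λ a → t a * S (λ k w → φ (suc (a ℕ.+ k)) (c₀ ℕ.+ (c₀ ℕ.* a ℕ.+ w)))) +
    ∑< m (λ i → g i * ∑< (suc b) (λ a → t a * S (λ k w →
      φ (suc (a ℕ.+ k)) (suc (d (suc i)) ℕ.+ (c₀ ℕ.* a ℕ.+ w)))))
      ≈⟨ ∑<-head m _ ⟨
    _ ∎
    where
    c₀ = suc (d 0)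
    L = linear p q
    S = ∑Box (d ∘ suc) (y ∘ suc) b m
    t : ℕ → Carrier
    t a = inv! a * y 0 ^ a
    φ′ : ℕ → ℕ → ℕ → Carrier
    φ′ a k w = φ (a ℕ.+ k) (c₀ ℕ.* a ℕ.+ w)
    g₀ = L 1 c₀ * y 0
    g : ℕ → Carrier
    g i = L 1 (suc (d (suc i))) * y (suc i)
    Ψ : ℕ → ℕ → Carrier
    Ψ a i = S (λ k w → φ′ a (suc k) (suc (d (suc i)) ℕ.+ w))
    F : ℕ → Carrier
    F a = (nat a * inv! a) * y 0 ^ a * L 1 c₀ * S (φ′ a)

    L-split : ∀ a k w → L (a ℕ.+ k) (c₀ ℕ.* a ℕ.+ w) ≈ nat a * L 1 c₀ + L k w
    L-split a k w = begin
      p * nat (a ℕ.+ k) + q * nat (c₀ ℕ.* a ℕ.+ w)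
        ≈⟨ +-cong (*-congˡ (nat-+ a k))
                  (*-congˡ (trans (nat-+ (c₀ ℕ.* a) w) (+-congʳ (nat-* c₀ a)))) ⟩
      p * (nat a + nat k) + q * (nat c₀ * nat a + nat w)
        ≈⟨ lem p q (nat a) (nat k) (nat c₀) (nat w) ⟩
      nat a * (p * 1# + q * nat c₀) + (p * nat k + q * nat w)
        ≈⟨ +-congʳ (*-congˡ (+-congʳ (*-congˡ nat-one))) ⟨
      nat a * L 1 c₀ + L k w ∎
      where
      lem : ∀ p q a k c w → p * (a + k) + q * (c * a + w) ≈
        a * (p * 1# + q * c) + (p * k + q * w)
      lem = solve 6 (λ p q a k c w → p :* (a :+ k) :+ q :* (c :* a :+ w) :=
        a :* (p :* con 1 :+ q :* c) :+ (p :* k :+ q :* w)) refl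

    supp′ : ∀ a k w → b ℕ.< w → φ′ a k w ≈ 0#
    supp′ a k w b<w = supp (a ℕ.+ k) _ (ℕ.<-≤-trans b<w (ℕ.m≤n+m w (c₀ ℕ.* a)))

    inner : ∀ a → S (λ k w → L (a ℕ.+ k) (c₀ ℕ.* a ℕ.+ w) * φ′ a k w) ≈
      nat a * L 1 c₀ * S (φ′ a) + ∑< m (λ i → g i * Ψ a i)
    inner a = begin
      S (λ k w → L (a ℕ.+ k) (c₀ ℕ.* a ℕ.+ w) * φ′ a k w)
        ≈⟨ ∑Box-cong (d ∘ suc) (y ∘ suc) b m (λ k w →
             trans (*-congʳ (L-split a k w)) (distribʳ _ _ _)) ⟩
      S (λ k w → nat a * L 1 c₀ * φ′ a k w + L k w * φ′ a k w)
        ≈⟨ ∑Box-+ (d ∘ suc) (y ∘ suc) b m _ _ ⟩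
      S (λ k w → nat a * L 1 c₀ * φ′ a k w) + S (λ k w → L k w * φ′ a k w)
        ≈⟨ +-cong (∑Box-*ˡ (d ∘ suc) (y ∘ suc) b m _ (φ′ a))
                  (euler p q (d ∘ suc) (y ∘ suc) b m (φ′ a) (supp′ a)) ⟩
      nat a * L 1 c₀ * S (φ′ a) + ∑< m (λ i → g i * Ψ a i) ∎

    split : ∀ a → t a * (nat a * L 1 c₀ * S (φ′ a) + ∑< m (λ i → g i * Ψ a i)) ≈
      F a + ∑< m (λ i → g i * (t a * Ψ a i))
    split a = begin
      t a * (nat a * L 1 c₀ * S (φ′ a) + ∑< m (λ i → g i * Ψ a i))
        ≈⟨ lem (inv! a) (y 0 ^ a) (nat a) (L 1 c₀) (S (φ′ a)) _ ⟩
      F a + t a * ∑< m (λ i → g i * Ψ a i)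
        ≈⟨ +-congˡ (∑<-*ˡ m (t a) _) ⟨
      F a + ∑< m (λ i → t a * (g i * Ψ a i))
        ≈⟨ +-congˡ (∑<-cong m λ i → *-swap (t a) (g i) (Ψ a i)) ⟩
      F a + ∑< m (λ i → g i * (t a * Ψ a i)) ∎
      where
      lem : ∀ u v n l s z → u * v * (n * l * s + z) ≈ (n * u) * v * l * s + u * v * z
      lem = solve 6 (λ u v n l s z → u :* v :* (n :* l :* s :+ z) :=
        (n :* u) :* v :* l :* s :+ u :* v :* z) refl

    F-zero : F 0 ≈ 0#
    F-zero = trans (*-congʳ (*-congʳ (*-congʳ (*-congʳ nat-zero)))) (lem _ _ _ _)
      where
      lem : ∀ u v w z → 0# * u * v * w * z ≈ 0#
      lem = solve 4 (λ u v w z → con 0 :* u :* v :* w :* z := con 0) refl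

    F-last : F (suc b) ≈ 0#
    F-last = trans (*-congˡ (∑Box-zero (d ∘ suc) (y ∘ suc) b m λ k w →
      supp (suc b ℕ.+ k) _ (ℕ.≤-trans (ℕ.m≤n*m (suc b) c₀) (ℕ.m≤m+n (c₀ ℕ.* suc b) w)))) (zeroʳ _)

    F-suc : ∀ a → F (suc a) ≈
      g₀ * (t a * S (λ k w → φ (suc (a ℕ.+ k)) (c₀ ℕ.+ (c₀ ℕ.* a ℕ.+ w))))
    F-suc a = begin
      nat (suc a) * inv! (suc a) * (y 0 * y 0 ^ a) * L 1 c₀ * S (φ′ (suc a))
        ≈⟨ *-cong (*-congʳ (*-congʳ (inv!-suc a)))
                  (∑Box-cong (d ∘ suc) (y ∘ suc) b m λ k w →
                    reflexive (≡.cong (φ (suc (a ℕ.+ k))) (weight-suc w))) ⟩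
      inv! a * (y 0 * y 0 ^ a) * L 1 c₀ * S (λ k w → φ (suc (a ℕ.+ k)) (c₀ ℕ.+ (c₀ ℕ.* a ℕ.+ w)))
        ≈⟨ lem (inv! a) (y 0) (y 0 ^ a) (L 1 c₀) _ ⟩
      g₀ * (t a * S (λ k w → φ (suc (a ℕ.+ k)) (c₀ ℕ.+ (c₀ ℕ.* a ℕ.+ w)))) ∎
      where
      weight-suc : ∀ w → c₀ ℕ.* suc a ℕ.+ w ≡ c₀ ℕ.+ (c₀ ℕ.* a ℕ.+ w)
      weight-suc w = ≡.trans (≡.cong (ℕ._+ w) (ℕ.*-suc c₀ a)) (ℕ.+-assoc c₀ (c₀ ℕ.* a) w)
      lem : ∀ u v v′ l s → u * (v * v′) * l * s ≈ l * v * (u * v′ * s)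
      lem = solve 5 (λ u v v′ l s → u :* (v :* v′) :* l :* s := l :* v :* (u :* v′ :* s)) refl

    first : ∑< (suc b) F ≈
      g₀ * ∑< (suc b) (λ a → t a * S (λ k w → φ (suc (a ℕ.+ k)) (c₀ ℕ.+ (c₀ ℕ.* a ℕ.+ w))))
    first = begin
      -- `F 0` vanishes through its factor `nat 0`, and `F (suc b)` because its weights exceed `b`.
      -- So the exponent may run from 1 to `suc b` instead, which leaves room to remove a unit.
      ∑< (suc b) F                      ≈⟨ ∑<-shift (suc b) F F-last ⟩
      F 0 + ∑< (suc b) (F ∘ suc)        ≈⟨ trans (+-congʳ F-zero) (+-identityˡ _) ⟩
      ∑< (suc b) (F ∘ suc)              ≈⟨ ∑<-cong (suc b) F-suc ⟩
      _                                 ≈⟨ ∑<-*ˡ (suc b) g₀ _ ⟩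
      _                                 ∎

    second : ∑< (suc b) (λ a → ∑< m (λ i → g i * (t a * Ψ a i))) ≈
      ∑< m (λ i → g i * ∑< (suc b) (λ a → t a * S (λ k w →
        φ (suc (a ℕ.+ k)) (suc (d (suc i)) ℕ.+ (c₀ ℕ.* a ℕ.+ w)))))
    second = trans (∑<-swap (suc b) m _) (∑<-cong m λ i →
      trans (∑<-*ˡ (suc b) (g i) _) (*-congˡ (∑<-cong (suc b) λ a → *-congˡ
        (∑Box-cong (d ∘ suc) (y ∘ suc) b m λ k w →
          reflexive (≡.cong₂ φ (ℕ.+-suc a k) (ℕ-swap (c₀ ℕ.* a) (suc (d (suc i))) w))))))

  -- Independence of the sum from the size of the box.

  -- If the last exponent is positive and the total is `suc k`, one unit weighs `suc (d m)` and the
  -- other `k` weigh at least 1 each. The weight then exceeds `k + d m`, where `φ` vanishes, so only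
  -- last exponent 0 survives.
  ∑Box-truncate : ∀ d y b m (φ : ℕ → ℕ → Carrier) →
    (∀ k w → k ℕ.+ d m ℕ.< w → φ (suc k) w ≈ 0#) →
    ∑Box d y b (suc m) φ ≈ ∑Box d y b m φ
  ∑Box-truncate d y b zero    φ φ≈0 = begin
    ∑< (suc b) (λ a → inv! a * y 0 ^ a * φ (a ℕ.+ 0) (c₀ ℕ.* a ℕ.+ 0))
      ≈⟨ ∑<-head b _ ⟩
    inv! 0 * 1# * φ 0 (c₀ ℕ.* 0 ℕ.+ 0) + ∑< b (λ a → inv! (suc a) * y 0 ^ suc a *
      φ (suc a ℕ.+ 0) (c₀ ℕ.* suc a ℕ.+ 0))
      ≈⟨ +-cong (*-cong (trans (*-identityʳ _) inv!-zero)
                  (reflexive (≡.cong (φ 0) (≡.cong (ℕ._+ 0) (ℕ.*-zeroʳ c₀)))))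
           (∑<-zero b λ a → trans (*-congˡ (φ≈0 _ _ (bound a))) (zeroʳ _)) ⟩
    1# * φ 0 0 + 0#
      ≈⟨ trans (+-identityʳ _) (*-identityˡ _) ⟩
    φ 0 0 ∎
    where
    c₀ = suc (d 0)
    bound : ∀ a → a ℕ.+ 0 ℕ.+ d 0 ℕ.< c₀ ℕ.* suc a ℕ.+ 0
    bound a = s≤s (ℕ.≤-trans
      (ℕ.+-mono-≤ (ℕ.≤-reflexive (ℕ.+-identityʳ a)) (ℕ.m≤m*n (d 0) (suc a)))
      (ℕ.m≤m+n _ 0))
  ∑Box-truncate d y b (suc m) φ φ≈0 = ∑<-cong (suc b) λ a → *-congˡ
    (∑Box-truncate (d ∘ suc) (y ∘ suc) b m _ λ k w lt →
      trans (reflexive (≡.cong (λ s → φ s (suc (d 0) ℕ.* a ℕ.+ w)) (ℕ.+-suc a k)))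
        (φ≈0 _ _ (ℕ.≤-<-trans (ℕ.≤-reflexive (ℕ.+-assoc a k _))
          (ℕ.+-mono-≤-< (ℕ.m≤n*m a (suc (d 0))) lt))))

  -- Drops the last variable repeatedly. It reconciles the n - k + 1 arguments of the Bell
  -- polynomials with a number of variables independent of k.
  ∑Box-dimension : ∀ y b {m M} (φ : ℕ → ℕ → Carrier) → m ℕ.≤′ M →
    (∀ k w → k ℕ.+ m ℕ.< w → φ (suc k) w ≈ 0#) →
    ∑Box id y b M φ ≈ ∑Box id y b m φ
  ∑Box-dimension y b φ ℕ.≤′-refl       φ≈0 = refl
  ∑Box-dimension y b φ (ℕ.≤′-step m≤M) φ≈0 = trans
    (∑Box-truncate id y b _ φ λ k w lt →
      φ≈0 k w (ℕ.≤-<-trans (ℕ.+-monoʳ-≤ k (ℕ.≤′⇒≤ m≤M)) lt))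
    (∑Box-dimension y b φ m≤M φ≈0)

  -- An exponent `suc b` in one coordinate already pushes the total above `b`, where `φ` vanishes.
  ∑Box-bound-suc : ∀ d y b m (φ : ℕ → ℕ → Carrier) → (∀ k w → b ℕ.< k → φ k w ≈ 0#) →
    ∑Box d y (suc b) m φ ≈ ∑Box d y b m φ
  ∑Box-bound-suc d y b zero    φ φ≈0 = refl
  ∑Box-bound-suc d y b (suc m) φ φ≈0 = begin
    _
      ≈⟨ ∑<-last (suc b) _ ⟩
    _ + _
      ≈⟨ +-cong (∑<-cong (suc b) λ a → *-congˡ (∑Box-bound-suc (d ∘ suc) (y ∘ suc) b m _
                  λ k w lt → φ≈0 (a ℕ.+ k) _ (ℕ.<-≤-trans lt (ℕ.m≤n+m k a))))
           (trans (*-congˡ (∑Box-zero (d ∘ suc) (y ∘ suc) (suc b) m λ k w →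
             φ≈0 (suc b ℕ.+ k) _ (ℕ.m≤m+n (suc b) k))) (zeroʳ _)) ⟩
    _ + 0#
      ≈⟨ +-identityʳ _ ⟩
    _ ∎

  ∑Box-bound : ∀ d y m {b B} (φ : ℕ → ℕ → Carrier) → b ℕ.≤′ B →
    (∀ k w → b ℕ.< k → φ k w ≈ 0#) → ∑Box d y B m φ ≈ ∑Box d y b m φ
  ∑Box-bound d y m φ ℕ.≤′-refl       φ≈0 = refl
  ∑Box-bound d y m φ (ℕ.≤′-step b≤B) φ≈0 = trans
    (∑Box-bound-suc d y _ m φ λ k w lt → φ≈0 k w (ℕ.≤-<-trans (ℕ.≤′⇒≤ b≤B) lt))
    (∑Box-bound d y m φ b≤B φ≈0)

  -- The Kronecker delta.

  δ : ℕ → ℕ → Carrier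
  δ zero    zero    = 1#
  δ zero    (suc n) = 0#
  δ (suc m) zero    = 0#
  δ (suc m) (suc n) = δ m n

  δ-refl : ∀ n → δ n n ≈ 1#
  δ-refl zero    = refl
  δ-refl (suc n) = δ-refl n

  δ-≢ : ∀ {m n} → m ≢ n → δ m n ≈ 0#
  δ-≢ {zero}  {zero}  m≢n = contradiction ≡.refl m≢n
  δ-≢ {zero}  {suc n} m≢n = refl
  δ-≢ {suc m} {zero}  m≢n = refl
  δ-≢ {suc m} {suc n} m≢n = δ-≢ (m≢n ∘ ≡.cong suc)

  δ-select : ∀ (f : ℕ → Carrier) m n → f m * δ m n ≈ f n * δ m n
  δ-select f zero    zero    = refl
  δ-select f zero    (suc n) = trans (zeroʳ _) (sym (zeroʳ _))
  δ-select f (suc m) zero    = trans (zeroʳ _) (sym (zeroʳ _))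
  δ-select f (suc m) (suc n) = δ-select (f ∘ suc) m n

  ∑<-δ : ∀ {m n} (f : ℕ → Carrier) → m ℕ.< n → ∑< n (λ i → f i * δ m i) ≈ f m
  ∑<-δ {zero} {suc n} f _ = begin
    _                    ≈⟨ ∑<-head n _ ⟩
    f 0 * 1# + ∑< n _    ≈⟨ +-cong (*-identityʳ _) (∑<-zero n λ _ → zeroʳ _) ⟩
    f 0 + 0#             ≈⟨ +-identityʳ _ ⟩
    f 0                  ∎
  ∑<-δ {suc m} {suc n} f (s≤s m<n) = begin
    _                    ≈⟨ ∑<-head n _ ⟩
    f 0 * 0# + ∑< n _    ≈⟨ +-cong (zeroʳ _) (∑<-δ (f ∘ suc) m<n) ⟩
    0# + f (suc m)       ≈⟨ +-identityˡ _ ⟩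
    f (suc m)            ∎

  -- Recurrences for falling factorials.

  -- The defining recursion freed of subtraction. It is applied to α, to β and to αβ.
  falling-step : ∀ x k → falling x (suc k) + nat k * falling x k ≈ x * falling x k
  falling-step x k = begin
    falling x (suc k) + nat k * falling x k
      ≈⟨ +-congʳ (falling-suc x k) ⟩
    falling x k * (x - nat k) + nat k * falling x k
      ≈⟨ lem (falling x k) x (- nat k) (nat k) ⟩
    (x + (- nat k + nat k)) * falling x k
      ≈⟨ *-congʳ (trans (+-congˡ (-‿inverseˡ _)) (+-identityʳ x)) ⟩
    x * falling x k ∎
    where
    lem : ∀ f x u n → f * (x + u) + n * f ≈ (x + (u + n)) * f
    lem = solve 4 (λ f x u n → f :* (x :+ u) :+ n :* f := (x :+ (u :+ n)) :* f) refl

  falling-cong : ∀ {x y} → x ≈ y → ∀ k → falling x k ≈ falling y k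
  falling-cong x≈y zero    = trans (falling-zero _) (sym (falling-zero _))
  falling-cong x≈y (suc k) = trans (falling-suc _ k)
    (trans (*-cong (falling-cong x≈y k) (+-congʳ x≈y)) (sym (falling-suc _ k)))

  binomial : Carrier → ℕ → Carrier
  binomial x k = falling x k * inv! k

  -- The recurrence for the coefficients T_n.

  -- N bounds both the number of variables and their exponents; T n has its
  -- intended value for n ≤ N only.
  module _ (α β : Carrier) (N : ℕ) where

    private
      y : ℕ → Carrier
      y i = binomial α (suc i)

      S : (ℕ → ℕ → Carrier) → Carrier
      S = ∑Box id y N N

      φ : ℕ → ℕ → ℕ → Carrier
      φ n k w = falling β k * δ w n

      T : ℕ → Carrier
      T n = S (φ n)

      -- For n ≤ N, the coefficient of t^(n-i) in G = β(1 + f)^(β-1), the derivative of (1 + f)^β in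
      -- f; zero for i > n. Writing `i + w` against `n` avoids truncated subtraction.
      H : ℕ → ℕ → Carrier
      H n i = S λ k w → falling β (suc k) * δ (i ℕ.+ w) n

      -- The coefficient of t^i in f′, as `y i` is that of t^(i+1) in f. Together `u-zero` and
      -- `u-suc` say (1 + t)f′ = α(1 + f).
      u : ℕ → Carrier
      u i = nat (suc i) * y i

      u≈ : ∀ i → u i ≈ falling α (suc i) * inv! i
      u≈ i = trans (*-swap _ _ _) (*-congˡ (inv!-suc i))

      u-zero : u 0 ≈ α
      u-zero = begin
        u 0                                ≈⟨ u≈ 0 ⟩
        falling α 1 * inv! 0               ≈⟨ *-congˡ inv!-zero ⟩
        falling α 1 * 1#                   ≈⟨ *-identityʳ _ ⟩
        falling α 1                        ≈⟨ +-identityʳ _ ⟨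
        falling α 1 + 0#                   ≈⟨ +-congˡ (trans (*-congʳ nat-zero) (zeroˡ _)) ⟨
        falling α 1 + nat 0 * falling α 0  ≈⟨ falling-step α 0 ⟩
        α * falling α 0                    ≈⟨ *-congˡ (falling-zero α) ⟩
        α * 1#                             ≈⟨ *-identityʳ α ⟩
        α                                  ∎

      u-suc : ∀ i → u (suc i) + u i ≈ α * y i
      u-suc i = begin
        u (suc i) + u i
          ≈⟨ +-cong (u≈ (suc i)) (sym (*-assoc _ _ _)) ⟩
        falling α (suc (suc i)) * inv! (suc i) + nat (suc i) * falling α (suc i) * inv! (suc i)
          ≈⟨ distribʳ _ _ _ ⟨
        (falling α (suc (suc i)) + nat (suc i) * falling α (suc i)) * inv! (suc i)
          ≈⟨ *-congʳ (falling-step α (suc i)) ⟩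
        α * falling α (suc i) * inv! (suc i)
          ≈⟨ *-assoc _ _ _ ⟩
        α * y i ∎

      supp : ∀ n → n ℕ.≤ N → ∀ k w → N ℕ.< w → φ n k w ≈ 0#
      supp n n≤N k w N<w = trans (*-congˡ (δ-≢ (ℕ.>⇒≢ (ℕ.≤-<-trans n≤N N<w)))) (zeroʳ _)

      -- The delta forces `w = n`, so the factor `nat n` can be read as the weight of the vector, to
      -- which `euler` applies.
      degree : ∀ n → n ℕ.≤ N → nat n * T n ≈ ∑< N λ i → u i * S (λ k w → φ n (suc k) (suc i ℕ.+ w))
      degree n n≤N = begin
        nat n * T n
          ≈⟨ ∑Box-*ˡ id y N N (nat n) (φ n) ⟨
        S (λ k w → nat n * φ n k w)
          ≈⟨ ∑Box-cong id y N N (λ k w → pointwise k w) ⟩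
        S (λ k w → linear 0# 1# k w * φ n k w)
          ≈⟨ euler 0# 1# id y N N (φ n) (supp n n≤N) ⟩
        ∑< N (λ i → linear 0# 1# 1 (suc i) * y i * S (λ k w → φ n (suc k) (suc i ℕ.+ w)))
          ≈⟨ ∑<-cong N (λ i → *-congʳ (*-congʳ (linear≈ 1 (suc i)))) ⟩
        ∑< N (λ i → u i * S (λ k w → φ n (suc k) (suc i ℕ.+ w))) ∎
        where
        linear≈ : ∀ k w → linear 0# 1# k w ≈ nat w
        linear≈ k w = trans (+-cong (zeroˡ _) (*-identityˡ _)) (+-identityˡ _)
        pointwise : ∀ k w → nat n * φ n k w ≈ linear 0# 1# k w * φ n k w
        pointwise k w = begin
          nat n * (falling β k * δ w n)          ≈⟨ *-swap _ _ _ ⟩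
          falling β k * (nat n * δ w n)          ≈⟨ *-congˡ (δ-select nat w n) ⟨
          falling β k * (nat w * δ w n)          ≈⟨ *-swap _ _ _ ⟩
          nat w * φ n k w                        ≈⟨ *-congʳ (linear≈ k w) ⟨
          linear 0# 1# k w * φ n k w             ∎

      -- The power series form is k · f^k / k! = f · f^(k-1) / (k-1)!: a factor `k` becomes a factor
      -- f in front of G.
      order : ∀ n → n ℕ.≤ N →
        S (λ k w → nat k * φ n k w) ≈ ∑< N λ i → y i * H n (suc i)
      order n n≤N = begin
        S (λ k w → nat k * φ n k w)
          ≈⟨ ∑Box-cong id y N N (λ k w → *-congʳ (linear≈ k w)) ⟨
        S (λ k w → linear 1# 0# k w * φ n k w)
          ≈⟨ euler 1# 0# id y N N (φ n) (supp n n≤N) ⟩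
        ∑< N (λ i → linear 1# 0# 1 (suc i) * y i * H n (suc i))
          ≈⟨ ∑<-cong N (λ i → *-congʳ
               (trans (*-congʳ (trans (linear≈ 1 (suc i)) nat-one)) (*-identityˡ _))) ⟩
        ∑< N (λ i → y i * H n (suc i)) ∎
        where
        linear≈ : ∀ k w → linear 1# 0# k w ≈ nat k
        linear≈ k w = trans (+-cong (*-identityˡ _) (zeroˡ _)) (+-identityʳ _)

    -- Coefficients of t^n in (1 + t)F′ = αβF for F = (1 + f)^β. As F′ = f′G, this combines (1 +
    -- t)f′ = α(1 + f) with (1 + f)G = βF.
    recurrence : ∀ n → n ℕ.< N → nat (suc n) * T (suc n) + nat n * T n ≈ α * β * T n
    recurrence n n<N = begin
      nat (suc n) * T (suc n) + nat n * T n
        -- `δ` strips a `suc` from both arguments, so `degree (suc n)` yields `H n i` by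
        -- computation.
        ≈⟨ +-cong (degree (suc n) n<N) (degree n n≤N) ⟩
      ∑< N (λ i → u i * H n i) + ∑< N (λ i → u i * H n (suc i))
        -- The term at `i = N` vanishes since `n < N`. After the shift both sums involve
        -- `H n (suc i)`.
        ≈⟨ +-congʳ (∑<-shift N _ (trans (*-congˡ H-last) (zeroʳ _))) ⟩
      u 0 * H n 0 + ∑< N (λ i → u (suc i) * H n (suc i)) + ∑< N (λ i → u i * H n (suc i))
        ≈⟨ trans (+-assoc _ _ _) (+-congˡ (sym (∑<-+ N _ _))) ⟩
      u 0 * H n 0 + ∑< N (λ i → u (suc i) * H n (suc i) + u i * H n (suc i))
        ≈⟨ +-cong (*-congʳ u-zero) (∑<-cong N λ i → trans (sym (distribʳ _ _ _))
             (trans (*-congʳ (u-suc i)) (*-assoc _ _ _))) ⟩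
      α * H n 0 + ∑< N (λ i → α * (y i * H n (suc i)))
        ≈⟨ trans (+-congˡ (∑<-*ˡ N α _)) (sym (distribˡ _ _ _)) ⟩
      α * (H n 0 + ∑< N (λ i → y i * H n (suc i)))
        -- The bracket is the coefficient of t^n in (1 + f)G. Its part from fG turns into a factor
        -- `k` inside the box sum, where `falling-step` for β applies.
        ≈⟨ *-congˡ (+-congˡ (order n n≤N)) ⟨
      α * (H n 0 + S (λ k w → nat k * φ n k w))
        ≈⟨ *-congˡ (∑Box-+ id y N N _ _) ⟨
      α * S (λ k w → falling β (suc k) * δ w n + nat k * φ n k w)
        ≈⟨ *-congˡ (∑Box-cong id y N N λ k w → pointwise k w) ⟩
      α * S (λ k w → β * φ n k w)
        ≈⟨ trans (*-congˡ (∑Box-*ˡ id y N N β (φ n))) (sym (*-assoc _ _ _)) ⟩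
      α * β * T n ∎
      where
      n≤N = ℕ.<⇒≤ n<N
      H-last : H n N ≈ 0#
      H-last = ∑Box-zero id y N N λ k w →
        trans (*-congˡ (δ-≢ (ℕ.>⇒≢ (ℕ.<-≤-trans n<N (ℕ.m≤m+n N w))))) (zeroʳ _)
      pointwise : ∀ k w → falling β (suc k) * δ w n + nat k * φ n k w ≈ β * φ n k w
      pointwise k w = begin
        falling β (suc k) * δ w n + nat k * φ n k w
          ≈⟨ +-congˡ (*-assoc _ _ _) ⟨
        falling β (suc k) * δ w n + nat k * falling β k * δ w n
          ≈⟨ distribʳ _ _ _ ⟨
        (falling β (suc k) + nat k * falling β k) * δ w n
          ≈⟨ *-congʳ (falling-step β k) ⟩
        β * falling β k * δ w n
          ≈⟨ *-assoc _ _ _ ⟩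
        β * φ n k w ∎

    T≈falling : ∀ n → n ℕ.≤ N → nat (n !) * T n ≈ falling (α * β) n
    T≈falling zero    _   = begin
      nat 1 * T 0
        ≈⟨ *-cong nat-one (∑Box-dimension y N {M = N} (φ 0) (ℕ.≤⇒≤′ z≤n)
             λ k w lt → trans (*-congˡ (δ-≢ (ℕ.>⇒≢ (ℕ.≤-<-trans z≤n lt)))) (zeroʳ _)) ⟩
      1# * (falling β 0 * 1#)
        ≈⟨ trans (*-identityˡ _) (trans (*-identityʳ _) (falling-zero β)) ⟩
      1#
        ≈⟨ falling-zero (α * β) ⟨
      falling (α * β) 0 ∎
    -- Both recurrences carry a term of index `n`, which is added to both sides and cancelled at the
    -- end. The factor `nat (suc n)` comes out of `suc n !`.
    T≈falling (suc n) n<N = +-cancelʳ (nat n * falling (α * β) n) _ _ (begin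
      nat (suc n !) * T (suc n) + nat n * falling (α * β) n
        ≈⟨ +-cong (*-congʳ (nat-* (suc n) (n !))) (*-congˡ (sym (T≈falling n n≤N))) ⟩
      nat (suc n) * nat (n !) * T (suc n) + nat n * (nat (n !) * T n)
        ≈⟨ lem (nat (suc n)) (nat (n !)) (T (suc n)) (nat n) (T n) ⟩
      nat (n !) * (nat (suc n) * T (suc n) + nat n * T n)
        ≈⟨ *-congˡ (recurrence n n<N) ⟩
      nat (n !) * (α * β * T n)
        ≈⟨ *-swap (nat (n !)) (α * β) (T n) ⟩
      α * β * (nat (n !) * T n)
        ≈⟨ *-congˡ (T≈falling n n≤N) ⟩
      α * β * falling (α * β) n
        ≈⟨ falling-step (α * β) n ⟨
      falling (α * β) (suc n) + nat n * falling (α * β) n ∎)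
      where
      open GroupProperties +-group renaming (∙-cancelʳ to +-cancelʳ)
      n≤N = ℕ.<⇒≤ n<N
      lem : ∀ s f t′ n t → s * f * t′ + n * (f * t) ≈ f * (s * t′ + n * t)
      lem = solve 5 (λ s f t′ n t → s :* f :* t′ :+ n :* (f :* t) :=
        f :* (s :* t′ :+ n :* t)) refl

  -- Sums over lists, and sums over `Λ` as box sums.

  ∑ₗ : {A : Set} → List A → (A → Carrier) → Carrier
  ∑ₗ xs f = List.foldr _+_ 0# (List.map f xs)

  ∑ₗ-cong : ∀ {A : Set} (xs : List A) {f g} → (∀ x → f x ≈ g x) → ∑ₗ xs f ≈ ∑ₗ xs g
  ∑ₗ-cong []       f≈g = refl
  ∑ₗ-cong (x ∷ xs) f≈g = +-cong (f≈g x) (∑ₗ-cong xs f≈g)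

  ∑ₗ-*ˡ : ∀ {A : Set} (xs : List A) x f → ∑ₗ xs (λ v → x * f v) ≈ x * ∑ₗ xs f
  ∑ₗ-*ˡ []       x f = sym (zeroʳ x)
  ∑ₗ-*ˡ (v ∷ xs) x f = trans (+-congˡ (∑ₗ-*ˡ xs x f)) (sym (distribˡ _ _ _))

  ∑ₗ-map-++ : ∀ {A B : Set} (g : A → B) xs ys f →
    ∑ₗ (List.map g xs ++ ys) f ≈ ∑ₗ xs (f ∘ g) + ∑ₗ ys f
  ∑ₗ-map-++ g []       ys f = sym (+-identityˡ _)
  ∑ₗ-map-++ g (x ∷ xs) ys f = trans (+-congˡ (∑ₗ-map-++ g xs ys f)) (sym (+-assoc _ _ _))

  ∑ₗ-cartesianProductWith : ∀ {A B C : Set} (g : A → B → C) xs ys f →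
    ∑ₗ (cartesianProductWith g xs ys) f ≈ ∑ₗ xs λ x → ∑ₗ ys λ y → f (g x y)
  ∑ₗ-cartesianProductWith g []       ys f = refl
  ∑ₗ-cartesianProductWith g (x ∷ xs) ys f =
    trans (∑ₗ-map-++ (g x) ys _ f) (+-congˡ (∑ₗ-cartesianProductWith g xs ys f))

  ∑ₗ-applyUpTo : ∀ {A : Set} (g : ℕ → A) n f → ∑ₗ (applyUpTo g n) f ≈ ∑< n (f ∘ g)
  ∑ₗ-applyUpTo g zero    f = sym (∑<-none _)
  ∑ₗ-applyUpTo g (suc n) f = trans (+-congˡ (∑ₗ-applyUpTo (g ∘ suc) n f)) (sym (∑<-head n _))

  -- Trades a filter for an indicator: in `∑ₗ-Λ`, `g` is `f` times a product of two deltas.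
  ∑ₗ-filter : ∀ {A : Set} {P : A → Set} (P? : Decidable P) xs {f g} →
    (∀ x → P x → f x ≈ g x) → (∀ x → ¬ P x → g x ≈ 0#) →
    ∑ₗ (filter P? xs) f ≈ ∑ₗ xs g
  ∑ₗ-filter P? []       f≈g g≈0 = refl
  ∑ₗ-filter P? (x ∷ xs) f≈g g≈0 with P? x
  ... | yes p = +-cong (f≈g x p) (∑ₗ-filter P? xs f≈g g≈0)
  ... | no ¬p = trans (∑ₗ-filter P? xs f≈g g≈0)
    (sym (trans (+-congʳ (g≈0 x ¬p)) (+-identityˡ _)))

  -- The factor `1#` mirrors the numerator in the summand of `Bell`, so that the two agree by
  -- computation at ℝ.
  monomial : ∀ {m} → (ℕ → Carrier) → Vec ℕ m → Carrier
  monomial y v = product λ i → 1# * inv! (lookup v i) * y (toℕ i) ^ lookup v i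

  weight : ∀ {m} → (ℕ → ℕ) → Vec ℕ m → ℕ
  weight d v = Vec.sum (tabulate λ i → suc (d (toℕ i)) ℕ.* lookup v i)

  ∑ₗ-box : ∀ d y b m φ →
    ∑ₗ (box b m) (λ v → monomial y v * φ (Vec.sum v) (weight d v)) ≈ ∑Box d y b m φ
  ∑ₗ-box d y b zero    φ = trans (+-identityʳ _) (*-identityˡ _)
  ∑ₗ-box d y b (suc m) φ = begin
    ∑ₗ (box b (suc m)) (λ v → monomial y v * φ (Vec.sum v) (weight d v))
      ≈⟨ ∑ₗ-cartesianProductWith _∷_ (upTo (suc b)) (box b m) _ ⟩
    ∑ₗ (upTo (suc b)) (λ a → ∑ₗ (box b m) λ v →
      1# * inv! a * y 0 ^ a * monomial (y ∘ suc) v * φ′ a (Vec.sum v) (weight (d ∘ suc) v))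
      ≈⟨ ∑ₗ-applyUpTo id (suc b) _ ⟩
    ∑< (suc b) (λ a → ∑ₗ (box b m) λ v →
      1# * inv! a * y 0 ^ a * monomial (y ∘ suc) v * φ′ a (Vec.sum v) (weight (d ∘ suc) v))
      ≈⟨ ∑<-cong (suc b) (λ a → trans
           (trans (∑ₗ-cong (box b m) λ v → *-assoc _ _ _) (∑ₗ-*ˡ (box b m) _ _))
           (*-cong (*-congʳ (*-identityˡ _)) (∑ₗ-box (d ∘ suc) (y ∘ suc) b m (φ′ a)))) ⟩
    ∑Box d y b (suc m) φ ∎
    where
    φ′ : ℕ → ℕ → ℕ → Carrier
    φ′ a k w = φ (a ℕ.+ k) (suc (d 0) ℕ.* a ℕ.+ w)

  -- The vectors of `Λ n k` have length and exponent bound depending on k. Once the filter is a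
  -- product of deltas, the box can be enlarged to `n` variables with exponents up to `n`, the same
  -- for every k.
  ∑ₗ-Λ : ∀ y {n j} → j ℕ.< n →
    ∑ₗ (Λ n (suc j)) (monomial y) ≈ ∑Box id y n n (λ k w → δ k (suc j) * δ w n)
  ∑ₗ-Λ y {n} {j} j<n = begin
    ∑ₗ (Λ n (suc j)) (monomial y)
      ≈⟨ ∑ₗ-filter (InΛ? n (suc j)) (box (suc j) m) inside outside ⟩
    ∑ₗ (box (suc j) m) (λ v → monomial y v * φ (Vec.sum v) (weight id v))
      ≈⟨ ∑ₗ-box id y (suc j) m φ ⟩
    ∑Box id y (suc j) m φ
      ≈⟨ ∑Box-bound id y m φ (ℕ.≤⇒≤′ j<n) (λ k w lt →
           trans (*-congʳ (δ-≢ (ℕ.>⇒≢ lt))) (zeroˡ _)) ⟨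
    ∑Box id y n m φ
      ≈⟨ ∑Box-dimension y n φ (ℕ.≤⇒≤′ m≤n) truncated ⟨
    ∑Box id y n n φ ∎
    where
    m = suc (n ∸ suc j)
    φ : ℕ → ℕ → Carrier
    φ k w = δ k (suc j) * δ w n
    m≤n : m ℕ.≤ n
    m≤n = ℕ.≤-trans (ℕ.≤-reflexive (≡.sym (ℕ.+-∸-assoc 1 j<n))) (ℕ.m∸n≤m n j)
    inside : ∀ v → _ → monomial y v ≈ monomial y v * φ (Vec.sum v) (weight id v)
    inside v (p , q) = begin
      monomial y v              ≈⟨ trans (*-congˡ (*-identityʳ _)) (*-identityʳ _) ⟨
      monomial y v * (1# * 1#)  ≈⟨ *-congˡ (*-cong (δ-refl (suc j)) (δ-refl n)) ⟨
      monomial y v * φ (suc j) n ≈⟨ *-congˡ (reflexive (≡.cong₂ φ p q)) ⟨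
      _                         ∎
    vanish : ∀ {k w} → ¬ (k ≡ suc j × w ≡ n) → φ k w ≈ 0#
    vanish {k} {w} ¬p with k ℕ.≟ suc j
    ... | no k≢ = trans (*-congʳ (δ-≢ k≢)) (zeroˡ _)
    ... | yes k≡ = trans (*-congˡ (δ-≢ λ w≡ → ¬p (k≡ , w≡))) (zeroʳ _)
    outside : ∀ v → _ → monomial y v * φ (Vec.sum v) (weight id v) ≈ 0#
    outside v ¬p = trans (*-congˡ (vanish ¬p)) (zeroʳ _)
    truncated : ∀ k w → k ℕ.+ m ℕ.< w → φ (suc k) w ≈ 0#
    -- At `k = j` and `w = n` the hypothesis would read `n < n`, because `j + suc (n ∸ suc j)` is
    -- `n`.
    truncated k w lt = vanish {suc k} {w} λ { (≡.refl , ≡.refl) → ℕ.<-irrefl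
      (≡.trans (ℕ.+-suc k _) (ℕ.m+[n∸m]≡n j<n)) lt }

  -- The sum of Bell polynomials.

  bellSum : Carrier → Carrier → ℕ → Carrier
  bellSum α β n = sum {n} λ i → falling β (suc (toℕ i)) *
    (nat (n !) * ∑ₗ (Λ n (suc (toℕ i))) (monomial λ j → binomial α (suc j)))

  bellSum≈falling : ∀ {α β γ} → α * β ≈ γ → ∀ n .{{_ : NonZero n}} →
    bellSum α β n ≈ falling γ n
  bellSum≈falling {α} {β} {γ} αβ≈γ n = begin
    sum {n} (λ i → falling β (suc (toℕ i)) * (nat (n !) * ∑ₗ (Λ n (suc (toℕ i))) (monomial y)))
      ≈⟨ sum-cong-≋ {n} (λ i → trans (*-congˡ (*-congˡ (∑ₗ-Λ y (toℕ<n i)))) (*-swap _ _ _)) ⟩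
    sum {n} (λ i → nat (n !) * (falling β (suc (toℕ i)) * D (toℕ i)))
      ≈⟨ ∑<-sum n _ ⟨
    ∑< n (λ i → nat (n !) * (falling β (suc i) * D i))
      ≈⟨ ∑<-*ˡ n (nat (n !)) _ ⟩
    nat (n !) * ∑< n (λ i → falling β (suc i) * D i)
      -- All terms now share one box, so the sum over k moves inside, where the delta picks out the
      -- total exponent of the vector.
      ≈⟨ *-congˡ (∑Box-∑ id y n n n (falling β ∘ suc) (λ i k w → δ k (suc i) * δ w n)) ⟨
    nat (n !) * ∑Box id y n n (λ k w → ∑< n λ i → falling β (suc i) * (δ k (suc i) * δ w n))
      ≈⟨ *-congˡ (∑Box-cong-on id y n n pointwise) ⟩
    nat (n !) * ∑Box id y n n (λ k w → falling β k * δ w n)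
      ≈⟨ T≈falling α β n n ℕ.≤-refl ⟩
    falling (α * β) n
      ≈⟨ falling-cong αβ≈γ n ⟩
    falling γ n ∎
    where
    y : ℕ → Carrier
    y j = binomial α (suc j)
    D : ℕ → Carrier
    D i = ∑Box id y n n (λ k w → δ k (suc i) * δ w n)
    pointwise : ∀ k w → k ℕ.≤ w → (k ≡ 0 → w ≡ 0) →
      (∑< n λ i → falling β (suc i) * (δ k (suc i) * δ w n)) ≈ falling β k * δ w n
    pointwise k w k≤w k0 with w ℕ.≟ n
    pointwise k       w k≤w k0 | no w≢n = trans
      (∑<-zero n λ i → trans (*-congˡ (trans (*-congˡ (δ-≢ w≢n)) (zeroʳ _))) (zeroʳ _))
      (sym (trans (*-congˡ (δ-≢ w≢n)) (zeroʳ _)))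
    -- The sum starts at k = 1. Total exponent 0 would force weight 0, but the weight is `n`, which
    -- is positive.
    pointwise zero    w k≤w k0 | yes ≡.refl = contradiction (k0 ≡.refl) (ℕ.≢-nonZero⁻¹ n)
    pointwise (suc k) w k≤w k0 | yes ≡.refl = begin
      ∑< n (λ i → falling β (suc i) * (δ k i * δ n n))
        ≈⟨ ∑<-cong n (λ i → trans (sym (*-assoc _ _ _)) (*-comm _ _)) ⟩
      ∑< n (λ i → δ n n * (falling β (suc i) * δ k i))
        ≈⟨ ∑<-*ˡ n (δ n n) _ ⟩
      δ n n * ∑< n (λ i → falling β (suc i) * δ k i)
        -- `k≤w` here reads `suc k ≤ n`, so the selected index `k` is in range.
        ≈⟨ *-congˡ (∑<-δ (falling β ∘ suc) k≤w) ⟩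
      δ n n * falling β (suc k)
        ≈⟨ *-comm _ _ ⟩
      falling β (suc k) * δ n n ∎

  *-one-minus-inverse : ∀ {x y} → x * y ≈ 1# → x * (1# - y) ≈ x - 1#
  *-one-minus-inverse {x} {y} xy≈1 = begin
    x * (1# - y)         ≈⟨ distribˡ x 1# (- y) ⟩
    x * 1# + x * - y     ≈⟨ +-cong (*-identityʳ x) (sym (-‿distribʳ-* x y)) ⟩
    x - x * y            ≈⟨ +-congˡ (-‿cong xy≈1) ⟩
    x - 1#               ∎
    where open RingProperties ring using (-‿distribʳ-*)

-- The real numbers as an instance.

open import Defs

-- Normalisation by the gcd blocks computation on variables. Identities are therefore checked on
-- unnormalised fractions, where they become equations between integers.
toℚᵘ-/ : ∀ i d → ℚ.toℚᵘ (i ℚ./ suc d) ℚᵘ.≃ mkℚᵘ i d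
toℚᵘ-/ i d = ℚ.toℚᵘ-fromℚᵘ (mkℚᵘ i d)

suc/1 : ∀ n → + suc n ℚ./ 1 ≡ 1ℚ ℚ.+ + n ℚ./ 1
suc/1 n = ℚ.toℚᵘ-injective (begin
  ℚ.toℚᵘ (+ suc n ℚ./ 1)                ≈⟨ toℚᵘ-/ (+ suc n) 0 ⟩
  mkℚᵘ (+ suc n) 0                      ≈⟨ *≡* (solve 1 (λ x → (con (+ 1) :+ x) :* con (+ 1)
                                             := (con (+ 1) :* con (+ 1) :+ x :* con (+ 1)) :* con (+ 1))
                                             ≡.refl (+ n)) ⟩
  mkℚᵘ (+ 1) 0 ℚᵘ.+ mkℚᵘ (+ n) 0        ≈⟨ ℚᵘ.+-congʳ (mkℚᵘ (+ 1) 0) (toℚᵘ-/ (+ n) 0) ⟨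
  ℚ.toℚᵘ 1ℚ ℚᵘ.+ ℚ.toℚᵘ (+ n ℚ./ 1)     ≈⟨ ℚ.toℚᵘ-homo-+ 1ℚ (+ n ℚ./ 1) ⟨
  ℚ.toℚᵘ (1ℚ ℚ.+ + n ℚ./ 1)             ∎)
  where
  open SetoidReasoning ℚᵘ.≃-setoid
  open ℤ.+-*-Solver

*-1/* : ∀ m d .{{_ : NonZero d}} .{{_ : NonZero (suc m ℕ.* d)}} →
  + suc m ℚ./ 1 ℚ.* (+ 1 ℚ./ (suc m ℕ.* d)) ≡ + 1 ℚ./ d
*-1/* m (suc d) = ℚ.toℚᵘ-injective (begin
  ℚ.toℚᵘ (p ℚ.* q)
    ≈⟨ ℚ.toℚᵘ-homo-* p q ⟩
  ℚ.toℚᵘ p ℚᵘ.* ℚ.toℚᵘ q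
    ≈⟨ ℚᵘ.*-cong (toℚᵘ-/ (+ suc m) 0) (toℚᵘ-/ (+ 1) (d ℕ.+ m ℕ.* suc d)) ⟩
  mkℚᵘ (+ suc m) 0 ℚᵘ.* mkℚᵘ (+ 1) (d ℕ.+ m ℕ.* suc d)
    ≈⟨ *≡* (≡.cong (+_) (solve 2 (λ m d →
         (con 1 :+ m) :* con 1 :* (con 1 :+ d)
         := con 1 :* (con 1 :* ((con 1 :+ m) :* (con 1 :+ d)))) ≡.refl m d)) ⟩
  mkℚᵘ (+ 1) d
    ≈⟨ toℚᵘ-/ (+ 1) d ⟨
  ℚ.toℚᵘ (+ 1 ℚ./ suc d) ∎)
  where
  open SetoidReasoning ℚᵘ.≃-setoid
  open ℕ.+-*-Solver
  p = + suc m ℚ./ 1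
  q = + 1 ℚ./ (suc m ℕ.* suc d)

1/!_ : ℕ → ℝ
1/! k = fromℚ (ℚ._/_ (+ 1) (k !) {{k ℕ.!≢0}})

≃-refl : ∀ x → x ≃ x
≃-refl x = IsEquivalence.refl ≃-isEquivalence {x}

ℝ-factorialRing : FactorialRing _ _
ℝ-factorialRing = record
  { commutativeRing = ℝ-commutativeRing
  ; nat          = fromℕ
  ; nat-zero     = ≃-refl 0ℝ
  ; nat-suc      = λ n → pointwise⇒≃ {fromℕ (suc n)} {1ℝ + fromℕ n} λ _ → suc/1 n
  ; inv!         = 1/!_
  ; inv!-zero    = ≃-refl 1ℝ
  ; inv!-suc     = λ n → pointwise⇒≃ {fromℕ (suc n) * 1/! suc n} {1/! n} λ _ →
      *-1/* n (n !) {{n ℕ.!≢0}} {{suc n ℕ.!≢0}}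
  ; falling      = falling
  ; falling-zero = λ _ → ≃-refl 1ℝ
  ; falling-suc  = λ x k → ≃-refl (falling x (suc k))
  }

theorem3p2 : (α : ℝ) (α#0 : α # 0ℝ) (n : ℕ) .{{_ : NonZero n}} →
    sum {n} (λ i → let k = suc (toℕ i) in
    falling (1ℝ - 1/ α [ α#0 ]) k * Bell n k (λ j → falling α (suc (toℕ j))))
    ≃ falling (α - 1ℝ) n
theorem3p2 α α#0 n = ≡.subst (_≃ falling (α - 1ℝ) n) bellSum≡
  (bellSum≈falling {α} {1ℝ - 1/ α [ α#0 ]} {α - 1ℝ}
    (*-one-minus-inverse {α} {1/ α [ α#0 ]} (*-inverseʳ α α#0)) n)
  where
  open BellSums ℝ-factorialRing using (bellSum; bellSum≈falling; *-one-minus-inverse)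
  bellSum≡ : bellSum α (1ℝ - 1/ α [ α#0 ]) n ≡
    sum {n} (λ i → falling (1ℝ - 1/ α [ α#0 ]) (suc (toℕ i)) *
      Bell n (suc (toℕ i)) (λ j → falling α (suc (toℕ j))))
  -- Each `x / k !` unfolds to a product with `1/! k`, so the summands of `Bell` are those of
  -- `monomial`.
  bellSum≡ = ≡.refl
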